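{- Let $t,n$ be positive integers with $t\ge 2n+1$, and let $C_t$ be the cycle with vertex set $\mathbb{Z}_t$ and edges $\{i,i+1\}$ for $i\in\mathbb{Z}_t$. If $\mathcal{F}$ is a collection of $n$ (not necessarily distinct) $2$-jump independent $n$-sets of $C_t$, then $\mathcal{F}$ has a rainbow independent $n$-set in $C_t$.
   Context: An ordered set $I=(a_1,\dots,a_n)$ of vertices of $C_t$ is a $2$-jump independent $n$-set of $C_t$ if $a_{i+1}-a_i\equiv 2 \pmod t$ for all $1\le i\le n-1$ (for $t\ge 2n+1$ this is an independent set of size $n$). For a collection $\mathcal{F}=(F_1,\dots,F_k)$ of sets, a rainbow set is a set $\{x_{i_1},\dots,x_{i_m}\}$ of $m$ distinct elements with distinct indices $i_1<\dots<i_m$ in $[k]$ and $x_{i_j}\in F_{i_j}$; a rainbow independent $n$-set is a rainbow set of size $n$ that is an independent set of $C_t$. -}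

module Defs where

open import Data.Nat using (ℕ; suc; _+_; _%_; _<_; NonZero)
open import Data.Fin using (Fin; toℕ)
import Data.Fin as F
open import Data.Product using (Σ; ∃; _×_)
open import Data.Sum using (_⊎_)
open import Relation.Binary.PropositionalEquality using (_≡_)
open import Relation.Nullary using (¬_)

Adjacent : (t : ℕ) → .{{NonZero t}} → Fin t → Fin t → Set
Adjacent t a b = (toℕ b ≡ (toℕ a + 1) % t) ⊎ (toℕ a ≡ (toℕ b + 1) % t)

Independent : (t : ℕ) → .{{NonZero t}} → {m : ℕ} → (Fin m → Fin t) → Set
Independent t x = ∀ i j → ¬ Adjacent t (x i) (x j)

TwoJump : (t : ℕ) → .{{NonZero t}} → (n : ℕ) → (Fin n → Fin t) → Set
TwoJump t n a = ∀ (i j : Fin n) → toℕ j ≡ suc (toℕ i) → toℕ (a j) ≡ (toℕ (a i) + 2) % t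

_∈ₑ_ : {t m : ℕ} → Fin t → (Fin m → Fin t) → Set
v ∈ₑ A = ∃ λ p → A p ≡ v

RainbowIndependentSet : (t : ℕ) → .{{NonZero t}} → {k s : ℕ} → (Fin k → Fin s → Fin t) → (m : ℕ) → Set
RainbowIndependentSet t {k} F m =
  Σ (Fin m → Fin k) λ ι → Σ (Fin m → Fin t) λ x →
    (∀ i j → i F.< j → ι i F.< ι j)
    × (∀ j → x j ∈ₑ F (ι j))
    × (∀ i j → x i ≡ x j → i ≡ j)
    × Independent t x

{-# OPTIONS --safe #-}
module Submission where

-- Let every set Fᵢ = {aᵢ, aᵢ + 2, …} park a car at its first element not yet taken by another car,
-- and let it park a second car in the same way from its last element backwards.  Since 2n < t,
-- some vertex v has v − 1 not occupied by a forward car and v − 2 not occupied by a backward car,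
-- so that no forward car has passed v − 1 and no backward car has passed v − 2.  Cut the cycle
-- before v and write t = 2n + 1 + e.  A set either lies inside the cut cycle, starting at distance
-- d ≤ e from v, or contains a stretch {0, 2, …, 2w}, or a stretch {e + 2b, …, e + 2(n − 1)}, with
-- w and b read off from the parked cars and hence distinct for distinct sets.  Order the sets by
-- w first, then d, then b.  The set of rank r receives 2r, d + 2r or e + 2r respectively: r ≤ w
-- and b ≤ r because the w's and the b's are distinct, and consecutive values differ by at least 2
-- because the offsets 0 ≤ d ≤ e increase.

open import Defs
open import Data.Nat using (ℕ; zero; suc; _+_; _*_; _∸_; _%_; _≤_; _<_; _<?_; _≤?_; z≤n; s≤s; s≤s⁻¹; NonZero)
open import Data.Nat.Properties
open import Data.Nat.DivMod using (m%n<n; m<n⇒m%n≡m; m%n%n≡m%n; %-distribˡ-+; [m+n]%n≡m%n)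
open import Data.Nat.Tactic.RingSolver using (solve-∀)
open import Data.Fin using (Fin; zero; suc; toℕ; fromℕ<; splitAt; _↑ˡ_; _↑ʳ_)
import Data.Fin.Properties as Fin
open import Data.Fin.Subset using (Subset; inside; outside; _∈_; _∉_; ∣_∣; ∁; ⊤)
open import Data.Fin.Subset.Properties
  using (∈⊤; ∣⊤∣≡n; ∣∁p∣≡n∸∣p∣; p⊂q⇒∣p∣<∣q∣; x∈∁p⇒x∉p)
open import Data.Vec using (_∷_; tabulate; here; there)
open import Data.Vec.Properties using (lookup∘tabulate; lookup⇒[]=; []=⇒lookup)
open import Data.Product using (Σ; ∃; _×_; _,_; proj₁; proj₂)
open import Data.Sum using (_⊎_; inj₁; inj₂; [_,_]′)
open import Function using (id; _∘_)
open import Relation.Nullary using (¬_; does; yes; no; contradiction)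
open import Relation.Nullary.Decidable using (dec-true; dec-false; decidable-stable)
open import Relation.Binary.Definitions using (tri<; tri≈; tri>)
open import Relation.Binary.PropositionalEquality

private variable
  m n : ℕ

-- Greedy parking, and a pigeonhole for the cut

-- Car `zero` parks after all the others. Those are m cars, and its `suc m` preferences are
-- distinct, so one is free and it takes the first such. The last conclusion is the one used for the
-- cut: a car never passes a vertex that stays free.
park : ∀ m (c : Fin m → ℕ → ℕ) →
  (∀ i {l l′} → l < m → l′ < m → c i l ≡ c i l′ → l ≡ l′) →
  Σ (Fin m → ℕ) λ k →
    (∀ i → k i < m)
    × (∀ i j → c i (k i) ≡ c j (k j) → i ≡ j)
    × (∀ i l → l ≤ k i → ∃ λ j → c j (k j) ≡ c i l)
park zero c _ = (λ ()) , (λ ()) , (λ ()) , (λ ())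
park (suc m) c c-inj
  with park m (c ∘ suc) (λ i l<m l′<m → c-inj (suc i) (m<n⇒m<1+n l<m) (m<n⇒m<1+n l′<m))
... | k , k<m , k-inj , k-least = k⁺ , k⁺< , k⁺-inj , k⁺-least
  where
  Taken : Fin (suc m) → Set
  Taken l = ∃ λ j → c (suc j) (k j) ≡ c zero (toℕ l)

  ¬allTaken : ¬ (∀ l → Taken l)
  ¬allTaken all with Fin.pigeonhole ≤-refl (proj₁ ∘ all)
  ... | l , l′ , l<l′ , eq = <⇒≢ l<l′ (c-inj zero (Fin.toℕ<n l) (Fin.toℕ<n l′)
    (trans (sym (proj₂ (all l)))
      (trans (cong (λ j → c (suc j) (k j)) eq) (proj₂ (all l′)))))

  firstFree = Fin.¬∀⟶∃¬-smallest (suc m) Taken (λ l → Fin.any? λ j → c (suc j) (k j) ≟ c zero (toℕ l)) ¬allTaken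
  l₀ = proj₁ firstFree

  k⁺ : Fin (suc m) → ℕ
  k⁺ zero = toℕ l₀
  k⁺ (suc i) = k i

  k⁺< : ∀ i → k⁺ i < suc m
  k⁺< zero = Fin.toℕ<n l₀
  k⁺< (suc i) = m<n⇒m<1+n (k<m i)

  k⁺-inj : ∀ i j → c i (k⁺ i) ≡ c j (k⁺ j) → i ≡ j
  k⁺-inj zero zero _ = refl
  k⁺-inj zero (suc j) eq = contradiction (j , sym eq) (proj₁ (proj₂ firstFree))
  k⁺-inj (suc i) zero eq = contradiction (i , eq) (proj₁ (proj₂ firstFree))
  k⁺-inj (suc i) (suc j) eq = cong suc (k-inj i j eq)

  k⁺-least : ∀ i l → l ≤ k⁺ i → ∃ λ j → c j (k⁺ j) ≡ c i l
  k⁺-least zero l l≤ with m≤n⇒m<n∨m≡n l≤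
  ... | inj₂ refl = zero , refl
  ... | inj₁ l<l₀ with proj₂ (proj₂ firstFree) (fromℕ< l<l₀)
  ...   | j , eq = suc j , trans eq (cong (c zero) (trans (Fin.toℕ-inject (fromℕ< l<l₀)) (Fin.toℕ-fromℕ< l<l₀)))
  k⁺-least (suc i) l l≤ with k-least i l l≤
  ... | j , eq = suc j , eq

missed-value : ∀ {t} → m < t → (f : Fin m → ℕ) → ∃ λ v → v < t × (∀ i → f i ≢ v)
missed-value {m} {t} m<t f
  with Fin.¬∀⟶∃¬ t (λ v → ∃ λ i → f i ≡ toℕ v) (λ v → Fin.any? λ i → f i ≟ toℕ v) ¬surj
  where
  ¬surj : ¬ (∀ (v : Fin t) → ∃ λ i → f i ≡ toℕ v)
  ¬surj surj with Fin.pigeonhole m<t (proj₁ ∘ surj)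
  ... | v , v′ , v<v′ , eq = <⇒≢ v<v′
    (trans (sym (proj₂ (surj v))) (trans (cong f eq) (proj₂ (surj v′))))
... | v , missed = toℕ v , Fin.toℕ<n v , λ i eq → missed (i , eq)

-- Ranks with respect to an injective key

enum : (p : Subset n) → Fin ∣ p ∣ → Fin n
enum (outside ∷ p) i = suc (enum p i)
enum (inside ∷ p) zero = zero
enum (inside ∷ p) (suc i) = suc (enum p i)

enum-∈ : (p : Subset n) → ∀ i → enum p i ∈ p
enum-∈ (outside ∷ p) i = there (enum-∈ p i)
enum-∈ (inside ∷ p) zero = here
enum-∈ (inside ∷ p) (suc i) = there (enum-∈ p i)

enum-injective : (p : Subset n) → ∀ {i j} → enum p i ≡ enum p j → i ≡ j
enum-injective (outside ∷ p) eq = enum-injective p (Fin.suc-injective eq)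
enum-injective (inside ∷ p) {zero} {zero} _ = refl
enum-injective (inside ∷ p) {suc i} {suc j} eq = cong suc (enum-injective p (Fin.suc-injective eq))

∣p∣≤bound : (p : Subset n) (f : Fin n → ℕ) → (∀ {i} → i ∈ p → f i < m) →
  (∀ {i j} → i ∈ p → j ∈ p → f i ≡ f j → i ≡ j) → ∣ p ∣ ≤ m
∣p∣≤bound p f f<m f-inj = Fin.injective⇒≤ {f = λ i → fromℕ< (f<m (enum-∈ p i))} λ {i} {j} eq →
  enum-injective p (f-inj (enum-∈ p i) (enum-∈ p j) (Fin.fromℕ<-injective _ _ _ _ eq))

module _ (key : Fin n → ℕ) where

  below : ℕ → Subset n
  below b = tabulate λ j → does (key j <? b)

  ∈below⁺ : ∀ {b j} → key j < b → j ∈ below b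
  ∈below⁺ {b} {j} lt = lookup⇒[]= j _ (trans (lookup∘tabulate _ j) (dec-true (key j <? b) lt))

  ∈below⁻ : ∀ {b j} → j ∈ below b → key j < b
  ∈below⁻ {b} {j} j∈ = decidable-stable (key j <? b) λ ¬lt → contradiction
    (trans (sym (dec-false (key j <? b) ¬lt)) (trans (sym (lookup∘tabulate _ j)) ([]=⇒lookup j∈)))
    λ ()

-- The rank counts the smaller keys. These are distinct numbers below `key i`, whence `ρ i ≤ key i`.
-- Dually, the `n ∸ ρ i` remaining keys are distinct numbers from `key i` up to `M`, whence the last
-- inequality.
rank : (key : Fin n → ℕ) → (∀ {i j} → key i ≡ key j → i ≡ j) → ∀ {M} → (∀ i → key i < M) →
  Σ (Fin n → ℕ) λ ρ →
    (∀ {i j} → key i < key j → ρ i < ρ j)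
    × (∀ i → ρ i < n)
    × (∀ i → ρ i ≤ key i)
    × (∀ i → n + key i ≤ M + ρ i)
rank {n} key key-inj {M} key<M = ρ , ρ-mono , ρ<n , ρ≤key , ρ-large
  where
  ρ : Fin n → ℕ
  ρ i = ∣ below key (key i) ∣

  i∉below : ∀ i → i ∉ below key (key i)
  i∉below i i∈ = <-irrefl refl (∈below⁻ key i∈)

  ρ-mono : ∀ {i j} → key i < key j → ρ i < ρ j
  ρ-mono {i} {j} lt = p⊂q⇒∣p∣<∣q∣
    ((λ x∈ → ∈below⁺ key (<-trans (∈below⁻ key x∈) lt)) , i , ∈below⁺ key lt , i∉below i)

  ρ<n : ∀ i → ρ i < n
  ρ<n i = subst (ρ i <_) (∣⊤∣≡n n) (p⊂q⇒∣p∣<∣q∣ ((λ _ → ∈⊤) , i , ∈⊤ , i∉below i))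

  ρ≤key : ∀ i → ρ i ≤ key i
  ρ≤key i = ∣p∣≤bound (below key (key i)) key (∈below⁻ key) (λ _ _ → key-inj)

  above : ∀ {i j} → j ∈ ∁ (below key (key i)) → key i ≤ key j
  above j∈ = ≮⇒≥ (x∈∁p⇒x∉p j∈ ∘ ∈below⁺ key)

  ρ-large : ∀ i → n + key i ≤ M + ρ i
  ρ-large i = begin
    n + key i                         ≤⟨ +-monoˡ-≤ (key i) (m≤n+m∸n n (ρ i)) ⟩
    ρ i + (n ∸ ρ i) + key i           ≡⟨ +-assoc (ρ i) _ _ ⟩
    ρ i + (n ∸ ρ i + key i)           ≤⟨ +-monoʳ-≤ (ρ i) (+-monoˡ-≤ (key i) size) ⟩
    ρ i + (M ∸ key i + key i)         ≡⟨ cong (ρ i +_) (m∸n+n≡m (<⇒≤ (key<M i))) ⟩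
    ρ i + M                           ≡⟨ +-comm (ρ i) M ⟩
    M + ρ i                           ∎
    where
    open ≤-Reasoning
    size : n ∸ ρ i ≤ M ∸ key i
    size = subst (_≤ M ∸ key i) (∣∁p∣≡n∸∣p∣ (below key (key i)))
      (∣p∣≤bound (∁ (below key (key i))) (λ j → key j ∸ key i)
        (λ {j} j∈ → ∸-monoˡ-< (key<M j) (above j∈))
        (λ i∈ j∈ eq → key-inj (∸-cancelʳ-≡ (above i∈) (above j∈) eq)))

-- Ordering the sets on the cut cycle

Apart : ℕ → ℕ → Set
Apart x y = 2 + x ≤ y ⊎ 2 + y ≤ x

-- The three ways a set can meet the cut cycle: early w contains 0, 2, …, 2w; middle d consists of
-- d, d + 2, …, d + 2(n − 1); late b contains e + 2b, …, e + 2(n − 1).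
data Kind : Set where
  early middle late : ℕ → Kind

module Arrangement (n e : ℕ) where

  Valid : Kind → Set
  Valid (early w) = w < n
  Valid (middle d) = d ≤ e
  Valid (late b) = b < n

  offset : Kind → ℕ
  offset (early _) = 0
  offset (middle d) = d
  offset (late _) = e

  Window : Kind → ℕ → Set
  Window (early w) r = r ≤ w
  Window (middle _) r = r < n
  Window (late b) r = b ≤ r × r < n

  -- Late sets get a level above `middle e`, although the offset is the same: their keys must form
  -- the topmost block, as those of early sets form the lowest.
  level : Kind → ℕ
  level (early _) = 0
  level (middle d) = 1 + d
  level (late _) = 2 + e

  level-≤⇒offset-≤ : ∀ κ κ′ → Valid κ → level κ ≤ level κ′ → offset κ ≤ offset κ′
  level-≤⇒offset-≤ (early _) κ′ _ _ = z≤n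
  level-≤⇒offset-≤ (middle _) (middle _) _ (s≤s d≤d′) = d≤d′
  level-≤⇒offset-≤ (middle _) (late _) d≤e _ = d≤e
  level-≤⇒offset-≤ (late _) (middle _) _ (s≤s e<d) = <⇒≤ e<d
  level-≤⇒offset-≤ (late _) (late _) _ _ = ≤-refl

  offset≤e : ∀ κ → Valid κ → offset κ ≤ e
  offset≤e (early _) _ = z≤n
  offset≤e (middle _) d≤e = d≤e
  offset≤e (late _) _ = ≤-refl

  level≤2+e : ∀ κ → Valid κ → level κ ≤ 2 + e
  level≤2+e (early _) _ = z≤n
  level≤2+e (middle _) d≤e = s≤s (m≤n⇒m≤1+n d≤e)
  level≤2+e (late _) _ = ≤-refl

  -- Several middle sets may share `d`, so the index separates them. For early and late sets the key
  -- has to carry `w` and `b` themselves, because `windowOf` reads them off.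
  tiebreak : Kind → Fin n → ℕ
  tiebreak (early w) _ = w
  tiebreak (middle _) i = toℕ i
  tiebreak (late b) _ = b

  tiebreak<n : ∀ κ i → Valid κ → tiebreak κ i < n
  tiebreak<n (early _) _ w<n = w<n
  tiebreak<n (middle _) i _ = Fin.toℕ<n i
  tiebreak<n (late _) _ b<n = b<n

  lex-< : ∀ {A A′ B B′} → B < n → A < A′ → A * n + B < A′ * n + B′
  lex-< {A} {A′} {B} {B′} B<n A<A′ = begin-strict
    A * n + B    <⟨ +-monoʳ-< (A * n) B<n ⟩
    A * n + n    ≡⟨ +-comm (A * n) n ⟩
    suc A * n    ≤⟨ *-monoˡ-≤ n A<A′ ⟩
    A′ * n       ≤⟨ m≤m+n (A′ * n) B′ ⟩
    A′ * n + B′  ∎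
    where open ≤-Reasoning

  arrange : (κ : Fin n → Kind) → (∀ i → Valid (κ i)) →
    (∀ {i j w} → κ i ≡ early w → κ j ≡ early w → i ≡ j) →
    (∀ {i j b} → κ i ≡ late b → κ j ≡ late b → i ≡ j) →
    Σ (Fin n → ℕ) λ ρ →
      (∀ i → Window (κ i) (ρ i))
      × (∀ i → 2 + (offset (κ i) + 2 * ρ i) ≤ e + 2 * n)
      × (∀ {i j} → i ≢ j → Apart (offset (κ i) + 2 * ρ i) (offset (κ j) + 2 * ρ j))
  arrange κ valid early-inj late-inj = ρ , window , bounded , apart
    where
    key : Fin n → ℕ
    key i = level (κ i) * n + tiebreak (κ i) i

    key-≤⇒level-≤ : ∀ {i j} → key i ≤ key j → level (κ i) ≤ level (κ j)
    key-≤⇒level-≤ {i} {j} le = ≮⇒≥ λ lt →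
      <⇒≱ (lex-< (tiebreak<n (κ j) j (valid j)) lt) le

    same : ∀ κ₁ κ₂ {i j} → κ i ≡ κ₁ → κ j ≡ κ₂ → Valid κ₁ → Valid κ₂ →
      level κ₁ ≡ level κ₂ → tiebreak κ₁ i ≡ tiebreak κ₂ j → i ≡ j
    same (early _) (early _) eq₁ eq₂ _ _ _ refl = early-inj eq₁ eq₂
    same (middle _) (middle _) _ _ _ _ _ eq = Fin.toℕ-injective eq
    same (middle d) (late _) _ _ d≤e _ eq _ = contradiction (suc-injective eq) (<⇒≢ (s≤s d≤e))
    same (late _) (middle d) _ _ _ d≤e eq _ = contradiction (sym (suc-injective eq)) (<⇒≢ (s≤s d≤e))
    same (late _) (late _) eq₁ eq₂ _ _ _ refl = late-inj eq₁ eq₂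

    key-inj : ∀ {i j} → key i ≡ key j → i ≡ j
    key-inj {i} {j} eq = same (κ i) (κ j) refl refl (valid i) (valid j) level≡
      (+-cancelˡ-≡ (level (κ i) * n) _ _ (trans eq (cong (λ A → A * n + _) (sym level≡))))
      where
      level≡ : level (κ i) ≡ level (κ j)
      level≡ = ≤-antisym (key-≤⇒level-≤ (≤-reflexive eq)) (key-≤⇒level-≤ (≤-reflexive (sym eq)))

    key< : ∀ i → key i < (3 + e) * n
    key< i = subst (key i <_) (+-identityʳ _)
      (lex-< (tiebreak<n (κ i) i (valid i)) (s≤s (level≤2+e (κ i) (valid i))))

    ranking = rank key key-inj key<
    ρ = proj₁ ranking
    ρ-mono = proj₁ (proj₂ ranking)
    ρ<n = proj₁ (proj₂ (proj₂ ranking))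
    ρ≤key = proj₁ (proj₂ (proj₂ (proj₂ ranking)))
    ρ-large = proj₂ (proj₂ (proj₂ (proj₂ ranking)))

    -- An early key is just `w`, so rank at most key gives `r ≤ w`. A late key is `(2 + e) * n + b`;
    -- adding `n` to it gives `(3 + e) * n + b`, and cancelling the bound `(3 + e) * n` on all keys
    -- leaves `b ≤ r`.
    windowOf : ∀ κ₁ i {r} → r < n → r ≤ level κ₁ * n + tiebreak κ₁ i →
      n + (level κ₁ * n + tiebreak κ₁ i) ≤ (3 + e) * n + r → Window κ₁ r
    windowOf (early _) _ _ r≤w _ = r≤w
    windowOf (middle _) _ r<n _ _ = r<n
    windowOf (late b) _ {r} r<n _ large = +-cancelˡ-≤ ((3 + e) * n) b r
      (≤-trans (≤-reflexive (+-assoc n ((2 + e) * n) b)) large) , r<n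

    window : ∀ i → Window (κ i) (ρ i)
    window i = windowOf (κ i) i (ρ<n i) (ρ≤key i) (ρ-large i)

    climb : ∀ {o o′ r r′} → o ≤ o′ → r < r′ → 2 + (o + 2 * r) ≤ o′ + 2 * r′
    climb {o} {o′} {r} {r′} o≤o′ r<r′ = begin
      2 + (o + 2 * r)  ≡⟨ shift o r ⟩
      o + 2 * suc r    ≤⟨ +-mono-≤ o≤o′ (*-monoʳ-≤ 2 r<r′) ⟩
      o′ + 2 * r′      ∎
      where
      open ≤-Reasoning
      shift : ∀ o r → 2 + (o + 2 * r) ≡ o + 2 * suc r
      shift = solve-∀

    -- Compares with a fictitious further set of offset `e` and rank `n`.
    bounded : ∀ i → 2 + (offset (κ i) + 2 * ρ i) ≤ e + 2 * n
    bounded i = climb (offset≤e (κ i) (valid i)) (ρ<n i)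

    step : ∀ {i j} → key i < key j → 2 + (offset (κ i) + 2 * ρ i) ≤ offset (κ j) + 2 * ρ j
    step {i} {j} lt = climb
      (level-≤⇒offset-≤ (κ i) (κ j) (valid i) (key-≤⇒level-≤ (<⇒≤ lt))) (ρ-mono lt)

    apart : ∀ {i j} → i ≢ j → Apart (offset (κ i) + 2 * ρ i) (offset (κ j) + 2 * ρ j)
    apart {i} {j} i≢j with <-cmp (key i) (key j)
    ... | tri< lt _ _ = inj₁ (step lt)
    ... | tri≈ _ eq _ = contradiction (key-inj eq) i≢j
    ... | tri> _ _ gt = inj₂ (step gt)

-- Arithmetic modulo t

module Modular (t : ℕ) .{{_ : NonZero t}} where

  %-+ˡ : ∀ x y → (x % t + y) % t ≡ (x + y) % t
  %-+ˡ x y = begin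
    (x % t + y) % t          ≡⟨ %-distribˡ-+ (x % t) y t ⟩
    (x % t % t + y % t) % t  ≡⟨ cong (λ z → (z + y % t) % t) (m%n%n≡m%n x t) ⟩
    (x % t + y % t) % t      ≡⟨ %-distribˡ-+ x y t ⟨
    (x + y) % t              ∎
    where open ≡-Reasoning

  %-+-cong : ∀ x x′ y → x % t ≡ x′ % t → (x + y) % t ≡ (x′ + y) % t
  %-+-cong x x′ y eq = trans (sym (%-+ˡ x y)) (trans (cong (λ z → (z + y) % t) eq) (%-+ˡ x′ y))

  %-+-cancelˡ : ∀ v y y′ → v < t → y < t → y′ < t → (v + y) % t ≡ (v + y′) % t → y ≡ y′
  %-+-cancelˡ v y y′ v<t y<t y′<t eq =
    trans (sym (undo y y<t)) (trans (%-+-cong (v + y) (v + y′) (t ∸ v) eq) (undo y′ y′<t))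
    where
    undo : ∀ y → y < t → (v + y + (t ∸ v)) % t ≡ y
    undo y y<t = begin
      (v + y + (t ∸ v)) % t    ≡⟨ cong (λ z → (z + (t ∸ v)) % t) (+-comm v y) ⟩
      (y + v + (t ∸ v)) % t    ≡⟨ cong (_% t) (+-assoc y v (t ∸ v)) ⟩
      (y + (v + (t ∸ v))) % t  ≡⟨ cong (λ z → (y + z) % t) (m+[n∸m]≡n (<⇒≤ v<t)) ⟩
      (y + t) % t              ≡⟨ [m+n]%n≡m%n y t ⟩
      y % t                    ≡⟨ m<n⇒m%n≡m y<t ⟩
      y                        ∎
      where open ≡-Reasoning

-- The element chosen from the i-th set lies at distance y i clockwise from the cut v.
record Placed (t : ℕ) .{{_ : NonZero t}} {n : ℕ} (a : Fin n → ℕ) : Set where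
  field
    v : ℕ
    v<t : v < t
    y : Fin n → ℕ
    y+1<t : ∀ i → y i + 1 < t
    apart : ∀ {i j} → i ≢ j → Apart (y i) (y j)
    element : ∀ i → ∃ λ l → l < n × (a i + 2 * l) % t ≡ (v + y i) % t

-- Locating each set relative to the cut

parity : ∀ r → ∃ λ s → r ≡ 2 * s ⊎ r ≡ suc (2 * s)
parity zero = 0 , inj₁ refl
parity (suc r) with parity r
... | s , inj₁ refl = s , inj₂ refl
... | s , inj₂ refl = suc s , inj₁ (sym (*-suc 2 s))

module Placement (t n e : ℕ) .{{_ : NonZero t}} (t≡ : t ≡ suc (2 * n + e))
  (a : Fin n → ℕ) (a<t : ∀ i → a i < t) where

  open Modular t
  open Arrangement n e

  2l<t : ∀ {l} → l ≤ n → 2 * l < t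
  2l<t l≤n = subst (_ <_) (sym t≡) (s≤s (≤-trans (*-monoʳ-≤ 2 l≤n) (m≤m+n (2 * n) e)))

  loc : Fin n → ℕ → ℕ
  loc i l = (a i + 2 * l) % t

  loc-inj : ∀ i {l l′} → l < n → l′ < n → loc i l ≡ loc i l′ → l ≡ l′
  loc-inj i {l} {l′} l<n l′<n eq = *-cancelˡ-≡ l l′ 2
    (%-+-cancelˡ (a i) (2 * l) (2 * l′) (a<t i) (2l<t (<⇒≤ l<n)) (2l<t (<⇒≤ l′<n)) eq)

  -- `k` is the forward parking; `k′` is the backward one, read through the index reversal
  -- `n ∸ suc l`. The last two hypotheses keep forward cars off v - 1 and backward cars off v - 2,
  -- phrased additively to avoid subtraction modulo `t`.
  module Cut
    (k k′ : Fin n → ℕ)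
    (k-inj : ∀ i j → loc i (k i) ≡ loc j (k j) → i ≡ j)
    (k-least : ∀ i l → l ≤ k i → ∃ λ j → loc j (k j) ≡ loc i l)
    (k′<n : ∀ i → k′ i < n)
    (k′-inj : ∀ i j → loc i (n ∸ suc (k′ i)) ≡ loc j (n ∸ suc (k′ j)) → i ≡ j)
    (k′-least : ∀ i l → l ≤ k′ i → ∃ λ j → loc j (n ∸ suc (k′ j)) ≡ loc i (n ∸ suc l))
    (v : ℕ) (v<t : v < t)
    (P+1≢v : ∀ i → (loc i (k i) + 1) % t ≢ v)
    (Q+2≢v : ∀ i → (loc i (n ∸ suc (k′ i)) + 2) % t ≢ v)
    where

    P Q : Fin n → ℕ
    P i = loc i (k i)
    Q i = loc i (n ∸ suc (k′ i))

    -- The clockwise distance from `v` to the first element.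
    d : Fin n → ℕ
    d i = (a i + (t ∸ v)) % t

    d<t : ∀ i → d i < t
    d<t i = m%n<n _ t

    loc≡ : ∀ i l → loc i l ≡ (v + (d i + 2 * l)) % t
    loc≡ i l = sym (begin
      (v + (d i + 2 * l)) % t                    ≡⟨ cong (_% t) (swap v (d i) (2 * l)) ⟩
      (d i + (v + 2 * l)) % t                    ≡⟨ %-+ˡ (a i + (t ∸ v)) (v + 2 * l) ⟩
      (a i + (t ∸ v) + (v + 2 * l)) % t          ≡⟨ cong (_% t) (regroup (a i) (t ∸ v) v (2 * l)) ⟩
      (a i + 2 * l + (t ∸ v + v)) % t            ≡⟨ cong (λ z → (a i + 2 * l + z) % t) (m∸n+n≡m (<⇒≤ v<t)) ⟩
      (a i + 2 * l + t) % t                      ≡⟨ [m+n]%n≡m%n (a i + 2 * l) t ⟩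
      loc i l                                    ∎)
      where
      open ≡-Reasoning
      swap : ∀ x y z → x + (y + z) ≡ y + (x + z)
      swap = solve-∀
      regroup : ∀ x y z w → x + y + (z + w) ≡ x + w + (y + z)
      regroup = solve-∀

    loc-offset : ∀ i l {x} → d i + 2 * l ≡ x → loc i l ≡ (v + x) % t
    loc-offset i l eq = trans (loc≡ i l) (cong (λ z → (v + z) % t) eq)

    loc-wrap : ∀ i l {x} → d i + 2 * l ≡ x + t → loc i l ≡ (v + x) % t
    loc-wrap i l {x} eq = trans (loc-offset i l eq)
      (trans (cong (_% t) (sym (+-assoc v x t))) ([m+n]%n≡m%n (v + x) t))

    reach : ∀ i l x → d i + 2 * l + x ≡ t → (loc i l + x) % t ≡ v
    reach i l x eq = begin
      (loc i l + x) % t              ≡⟨ cong (λ z → (z + x) % t) (loc≡ i l) ⟩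
      ((v + (d i + 2 * l)) % t + x) % t  ≡⟨ %-+ˡ (v + (d i + 2 * l)) x ⟩
      (v + (d i + 2 * l) + x) % t    ≡⟨ cong (_% t) (+-assoc v _ x) ⟩
      (v + (d i + 2 * l + x)) % t    ≡⟨ cong (λ z → (v + z) % t) eq ⟩
      (v + t) % t                    ≡⟨ [m+n]%n≡m%n v t ⟩
      v % t                          ≡⟨ m<n⇒m%n≡m v<t ⟩
      v                              ∎
      where open ≡-Reasoning

    -- In early, δ counts the elements of the set that precede v; in late, the elements from index
    -- n ∸ h on (v − 1, v + 1, …) are given up.  The parameters w and b locate the parked cars Q i and P i.
    data Spot (i : Fin n) : Kind → Set where
      early : ∀ {w} δ → d i + 2 * δ ≡ t → δ + w ≡ n ∸ suc (k′ i) → Spot i (early w)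
      middle : ∀ {c} → d i ≡ c → c ≤ e → Spot i (middle c)
      late : ∀ {b} h → d i ≡ e + 2 * h → h + k i ≡ b → b < n → Spot i (late b)

    -- Index `n ∸ h` falls on v - 1. If `h + k i` were at least `n`, the forward car would have
    -- reached or passed that index, so v - 1 would be occupied.
    spot-late : ∀ i h → d i ≡ e + 2 * h → h ≤ n → ∃ (Spot i)
    spot-late i h d≡ h≤n with h + k i <? n
    ... | yes b<n = late (h + k i) , late h d≡ refl b<n
    ... | no b≮n with k-least i (n ∸ h) (m≤n+o⇒m∸n≤o n h (≮⇒≥ b≮n))
    ...   | j , eq = contradiction (trans (cong (λ z → (z + 1) % t) eq) (reach i (n ∸ h) 1 (begin
      d i + 2 * (n ∸ h) + 1        ≡⟨ cong (λ z → z + 2 * (n ∸ h) + 1) d≡ ⟩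
      e + 2 * h + 2 * (n ∸ h) + 1  ≡⟨ factor e h (n ∸ h) ⟩
      suc (2 * (h + (n ∸ h)) + e)  ≡⟨ cong (λ z → suc (2 * z + e)) (m+[n∸m]≡n h≤n) ⟩
      suc (2 * n + e)              ≡⟨ t≡ ⟨
      t                            ∎))) (P+1≢v j)
      where
      open ≡-Reasoning
      factor : ∀ e h g → e + 2 * h + 2 * g + 1 ≡ suc (2 * (h + g) + e)
      factor = solve-∀

    -- Index `δ` falls on v - 2, and index `suc δ` would fall on `v`. A backward car parked at index
    -- `δ` or lower would make v - 2 occupied, so it parks beyond the cut.
    spot-early : ∀ i δ → d i + 2 * suc δ ≡ t → δ < n → ∃ (Spot i)
    spot-early i δ d≡ δ<n with suc δ ≤? n ∸ suc (k′ i)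
    ... | yes δ≤ = early (n ∸ suc (k′ i) ∸ suc δ) , early (suc δ) d≡ (m+[n∸m]≡n δ≤)
    ... | no δ≰ with k′-least i (n ∸ suc δ) l≤
      where
      -- `n ∸ suc δ` is the place of index `δ` in the backward order.
      l≤ : n ∸ suc δ ≤ k′ i
      l≤ = m≤n+o⇒m∸n≤o n (suc δ) (begin
        n                              ≤⟨ m≤n+m∸n n (suc (k′ i)) ⟩
        suc (k′ i) + (n ∸ suc (k′ i))  ≤⟨ +-monoʳ-≤ (suc (k′ i)) (s≤s⁻¹ (≰⇒> δ≰)) ⟩
        suc (k′ i + δ)                 ≡⟨ cong suc (+-comm (k′ i) δ) ⟩
        suc δ + k′ i                   ∎)
        where open ≤-Reasoning
    ...   | j , eq = contradiction (trans (cong (λ z → (z + 2) % t) eq) (reach i (n ∸ suc (n ∸ suc δ)) 2 (begin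
      d i + 2 * (n ∸ suc (n ∸ suc δ)) + 2  ≡⟨ cong (λ z → d i + 2 * z + 2) flip ⟩
      d i + 2 * δ + 2                      ≡⟨ shift (d i) δ ⟩
      d i + 2 * suc δ                      ≡⟨ d≡ ⟩
      t                                    ∎))) (Q+2≢v j)
      where
      open ≡-Reasoning
      flip : n ∸ suc (n ∸ suc δ) ≡ δ
      flip = begin
        n ∸ suc (n ∸ suc δ)  ≡⟨ cong (n ∸_) (+-∸-assoc 1 δ<n) ⟨
        n ∸ (n ∸ δ)          ≡⟨ m∸[m∸n]≡n (<⇒≤ δ<n) ⟩
        δ                    ∎
      shift : ∀ d δ → d + 2 * δ + 2 ≡ d + 2 * suc δ
      shift = solve-∀

    -- With `d i` at most `e` the whole set fits before the cut. Otherwise parity decides: the jumps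
    -- land either on v - 1 (late) or, skipping it, on `v` (early).
    spot : ∀ i → ∃ (Spot i)
    spot i with d i ≤? e
    ... | yes d≤e = middle (d i) , middle refl d≤e
    ... | no d≰e with m≤n⇒∃[o]m+o≡n (≰⇒> d≰e)
    ...   | r , e+r≡d with parity r | r<2n
      where
      r<2n : r < 2 * n
      r<2n = +-cancelˡ-< (suc e) r (2 * n)
        (subst₂ _<_ (sym e+r≡d) (trans t≡ (cong suc (+-comm (2 * n) e))) (d<t i))
    ...     | s , inj₂ refl | r<2n = spot-late i (suc s) (trans (sym e+r≡d) (shift e s))
      (*-cancelˡ-< 2 s n (<⇒≤ r<2n))
      where
      shift : ∀ e s → suc e + suc (2 * s) ≡ e + 2 * suc s
      shift = solve-∀
    ...     | s , inj₁ refl | r<2n = spot-early i (n ∸ suc s) (begin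
      d i + 2 * suc (n ∸ suc s)              ≡⟨ cong (_+ 2 * suc (n ∸ suc s)) e+r≡d ⟨
      suc e + 2 * s + 2 * suc (n ∸ suc s)    ≡⟨ factor e s (n ∸ suc s) ⟩
      suc (2 * (suc s + (n ∸ suc s)) + e)    ≡⟨ cong (λ z → suc (2 * z + e)) (m+[n∸m]≡n s<n) ⟩
      suc (2 * n + e)                        ≡⟨ t≡ ⟨
      t                                      ∎) (∸-monoʳ-< (s≤s z≤n) s<n)
      where
      open ≡-Reasoning
      s<n : s < n
      s<n = *-cancelˡ-< 2 s n r<2n
      factor : ∀ e s g → suc e + 2 * s + 2 * suc g ≡ suc (2 * (suc s + g) + e)
      factor = solve-∀

    flip<n : ∀ i → n ∸ suc (k′ i) < n
    flip<n i = ∸-monoʳ-< (s≤s z≤n) (k′<n i)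

    spot-valid : ∀ {i κ} → Spot i κ → Valid κ
    spot-valid {i} (early {w} δ _ δ+w≡) = ≤-<-trans (m≤n+m w δ) (subst (_< n) (sym δ+w≡) (flip<n i))
    spot-valid (middle _ d≤e) = d≤e
    spot-valid (late _ _ _ b<n) = b<n

    regroup : ∀ d δ w → d + 2 * (δ + w) ≡ 2 * w + (d + 2 * δ)
    regroup = solve-∀

    factor : ∀ e h g → e + 2 * h + 2 * g ≡ e + 2 * (h + g)
    factor = solve-∀

    -- Makes `w` determine the backward parked vertex, so `k′-inj` separates early sets; `late-P`
    -- does the same for `b` with `k-inj`.
    early-Q : ∀ {i w} → Spot i (early w) → Q i ≡ (v + 2 * w) % t
    early-Q {i} {w} (early δ d≡ δ+w≡) = loc-wrap i (n ∸ suc (k′ i)) (begin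
      d i + 2 * (n ∸ suc (k′ i))  ≡⟨ cong (λ z → d i + 2 * z) δ+w≡ ⟨
      d i + 2 * (δ + w)           ≡⟨ regroup (d i) δ w ⟩
      2 * w + (d i + 2 * δ)       ≡⟨ cong (2 * w +_) d≡ ⟩
      2 * w + t                   ∎)
      where
      open ≡-Reasoning

    late-P : ∀ {i b} → Spot i (late b) → P i ≡ (v + (e + 2 * b)) % t
    late-P {i} {b} (late h d≡ h+k≡ _) = loc-offset i (k i) (begin
      d i + 2 * k i          ≡⟨ cong (_+ 2 * k i) d≡ ⟩
      e + 2 * h + 2 * k i    ≡⟨ factor e h (k i) ⟩
      e + 2 * (h + k i)      ≡⟨ cong (λ z → e + 2 * z) h+k≡ ⟩
      e + 2 * b              ∎)
      where
      open ≡-Reasoning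

    -- Rank `r` is served by index `δ + r` in an early set, since its first `δ` elements precede the
    -- cut, and by index `r ∸ h` in a late set, which starts `h` jumps after `e`.
    attained : ∀ {i κ r} → Spot i κ → Window κ r → ∃ λ l → l < n × loc i l ≡ (v + (offset κ + 2 * r)) % t
    attained {i} {r = r} (early {w} δ d≡ δ+w≡) r≤w = δ + r ,
      ≤-<-trans (+-monoʳ-≤ δ r≤w) (subst (_< n) (sym δ+w≡) (flip<n i)) ,
      loc-wrap i (δ + r) (trans (regroup (d i) δ r) (cong (2 * r +_) d≡))
    attained {i} {r = r} (middle d≡ _) r<n = r , r<n , loc-offset i r (cong (_+ 2 * r) d≡)
    attained {i} {r = r} (late {b} h d≡ h+k≡ _) (b≤r , r<n) = r ∸ h , ≤-<-trans (m∸n≤m r h) r<n ,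
      loc-offset i (r ∸ h) (begin
        d i + 2 * (r ∸ h)          ≡⟨ cong (_+ 2 * (r ∸ h)) d≡ ⟩
        e + 2 * h + 2 * (r ∸ h)    ≡⟨ factor e h (r ∸ h) ⟩
        e + 2 * (h + (r ∸ h))      ≡⟨ cong (λ z → e + 2 * z) (m+[n∸m]≡n h≤r) ⟩
        e + 2 * r                  ∎)
      where
      open ≡-Reasoning
      h≤r : h ≤ r
      h≤r = ≤-trans (≤-trans (m≤m+n h (k i)) (≤-reflexive h+k≡)) b≤r

    placed : Placed t a
    placed = record
      { v = v
      ; v<t = v<t
      ; y = λ i → offset (κ i) + 2 * ρ i
      ; y+1<t = λ i → y+1<t (proj₁ (proj₂ (proj₂ arranged)) i)
      ; apart = proj₂ (proj₂ (proj₂ arranged))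
      ; element = λ i → attained (proj₂ (spot i)) (proj₁ (proj₂ arranged) i)
      }
      where
      κ : Fin n → Kind
      κ = proj₁ ∘ spot

      spotOf : ∀ {i κ′} → κ i ≡ κ′ → Spot i κ′
      spotOf {i} eq = subst (Spot i) eq (proj₂ (spot i))

      arranged = arrange κ (λ i → spot-valid (proj₂ (spot i)))
        (λ {i} {j} eqᵢ eqⱼ → k′-inj i j
          (trans (early-Q (spotOf eqᵢ)) (sym (early-Q (spotOf eqⱼ)))))
        (λ {i} {j} eqᵢ eqⱼ → k-inj i j
          (trans (late-P (spotOf eqᵢ)) (sym (late-P (spotOf eqⱼ)))))
      ρ = proj₁ arranged

      y+1<t : ∀ {y} → 2 + y ≤ e + 2 * n → y + 1 < t
      y+1<t {y} 2+y≤ = begin-strict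
        y + 1            ≡⟨ +-comm y 1 ⟩
        1 + y            <⟨ 2+y≤ ⟩
        e + 2 * n        ≡⟨ +-comm e (2 * n) ⟩
        2 * n + e        <⟨ n<1+n _ ⟩
        suc (2 * n + e)  ≡⟨ t≡ ⟨
        t                ∎
        where open ≤-Reasoning

  placement : Placed t a
  placement with park n loc loc-inj | park n (λ i l → loc i (n ∸ suc l)) flipped-inj
    where
    flipped-inj : ∀ i {l l′} → l < n → l′ < n → loc i (n ∸ suc l) ≡ loc i (n ∸ suc l′) → l ≡ l′
    flipped-inj i l<n l′<n eq = suc-injective (∸-cancelˡ-≡ l<n l′<n
      (loc-inj i (∸-monoʳ-< (s≤s z≤n) l<n) (∸-monoʳ-< (s≤s z≤n) l′<n) eq))
  ... | k , _ , k-inj , k-least | k′ , k′<n , k′-inj , k′-least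
    -- The cut must avoid the successor of each forward car and the second successor of each
    -- backward car: 2n values in all, fewer than `t`.
    with missed-value {n + n} {t} 2n<t
      ([ (λ i → (loc i (k i) + 1) % t) , (λ i → (loc i (n ∸ suc (k′ i)) + 2) % t) ]′ ∘ splitAt n)
    where
    2n<t : n + n < t
    2n<t = subst (_< t) (cong (n +_) (+-identityʳ n)) (2l<t ≤-refl)
  ... | v , v<t , missed = Cut.placed k k′ k-inj k-least k′<n k′-inj k′-least v v<t
    (λ i eq → missed (i ↑ˡ n) (trans (cong [ _ , _ ]′ (Fin.splitAt-↑ˡ n i n)) eq))
    (λ i eq → missed (n ↑ʳ i) (trans (cong [ _ , _ ]′ (Fin.splitAt-↑ʳ n n i)) eq))

-- From distances back to vertices of the cycle

Apart⇒≢ : ∀ {x y} → Apart x y → x ≢ y × y ≢ x + 1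
Apart⇒≢ {x} (inj₁ 2+x≤y) = (λ { refl → 1+n≰n (<⇒≤ 2+x≤y) }) ,
  λ { refl → 1+n≰n (subst (2 + x ≤_) (+-comm x 1) 2+x≤y) }
Apart⇒≢ {x} {y} (inj₂ 2+y≤x) = (λ { refl → 1+n≰n (<⇒≤ 2+y≤x) }) ,
  λ eq → 1+n≰n (≤-trans (m≤n⇒m≤1+n (s≤s (m≤m+n x 1))) (subst (λ z → 2 + z ≤ x) eq 2+y≤x))

twoJump-from-start : ∀ t .{{_ : NonZero t}} {n} (A : Fin (suc n) → Fin t) → TwoJump t (suc n) A →
  ∀ {l} (l<n : l < suc n) → toℕ (A (fromℕ< l<n)) ≡ (toℕ (A zero) + 2 * l) % t
twoJump-from-start t A jump {zero} (s≤s _) =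
  trans (sym (m<n⇒m%n≡m (Fin.toℕ<n (A zero)))) (cong (_% t) (sym (+-identityʳ _)))
twoJump-from-start t A jump {suc l} l<n = begin
  toℕ (A (fromℕ< l<n))                   ≡⟨ jump (fromℕ< l<n′) (fromℕ< l<n) index ⟩
  (toℕ (A (fromℕ< l<n′)) + 2) % t        ≡⟨ cong (λ z → (z + 2) % t) (twoJump-from-start t A jump l<n′) ⟩
  ((toℕ (A zero) + 2 * l) % t + 2) % t   ≡⟨ %-+ˡ (toℕ (A zero) + 2 * l) 2 ⟩
  (toℕ (A zero) + 2 * l + 2) % t         ≡⟨ cong (_% t) (shift (toℕ (A zero)) l) ⟩
  (toℕ (A zero) + 2 * suc l) % t         ∎
  where
  open ≡-Reasoning
  open Modular t
  l<n′ = <⇒≤ l<n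
  index : toℕ (fromℕ< l<n) ≡ suc (toℕ (fromℕ< l<n′))
  index = trans (Fin.toℕ-fromℕ< l<n) (cong suc (sym (Fin.toℕ-fromℕ< l<n′)))
  shift : ∀ a l → a + 2 * l + 2 ≡ a + 2 * suc l
  shift = solve-∀

module Rainbow (t n : ℕ) .{{_ : NonZero t}}
  (F : Fin (suc n) → Fin (suc n) → Fin t) (jump : ∀ i → TwoJump t (suc n) (F i))
  (placement : Placed t (λ i → toℕ (F i zero)))
  where

  open Modular t
  open Placed placement

  y<t : ∀ i → y i < t
  y<t i = ≤-<-trans (m≤m+n (y i) 1) (y+1<t i)

  x : Fin (suc n) → Fin t
  x i = F i (fromℕ< (proj₁ (proj₂ (element i))))

  x∈F : ∀ i → x i ∈ₑ F i
  x∈F i = _ , refl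

  toℕ-x : ∀ i → toℕ (x i) ≡ (v + y i) % t
  toℕ-x i = trans (twoJump-from-start t (F i) (jump i) (proj₁ (proj₂ (element i)))) (proj₂ (proj₂ (element i)))

  x-inj : ∀ i j → x i ≡ x j → i ≡ j
  x-inj i j eq = decidable-stable (i Fin.≟ j) λ i≢j → proj₁ (Apart⇒≢ (apart i≢j))
    (%-+-cancelˡ v (y i) (y j) v<t (y<t i) (y<t j)
      (trans (sym (toℕ-x i)) (trans (cong toℕ eq) (toℕ-x j))))

  -- Since `y i + 1` is still below `t`, a successor never crosses the cut, and adjacency on the
  -- cycle becomes adjacency of distances.
  next⇒suc : ∀ i j → toℕ (x j) ≡ (toℕ (x i) + 1) % t → y j ≡ y i + 1
  next⇒suc i j eq = %-+-cancelˡ v (y j) (y i + 1) v<t (y<t j) (y+1<t i) (begin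
    (v + y j) % t            ≡⟨ toℕ-x j ⟨
    toℕ (x j)                ≡⟨ eq ⟩
    (toℕ (x i) + 1) % t      ≡⟨ cong (λ z → (z + 1) % t) (toℕ-x i) ⟩
    ((v + y i) % t + 1) % t  ≡⟨ %-+ˡ (v + y i) 1 ⟩
    (v + y i + 1) % t        ≡⟨ cong (_% t) (+-assoc v (y i) 1) ⟩
    (v + (y i + 1)) % t      ∎)
    where open ≡-Reasoning

  notNext : ∀ i j → toℕ (x j) ≢ (toℕ (x i) + 1) % t
  notNext i j eq with i Fin.≟ j
  -- `Independent` also ranges over equal indices, so a vertex must be shown not to follow itself.
  ... | yes refl = 1+n≢n (trans (+-comm 1 (y i)) (sym (next⇒suc i i eq)))
  ... | no i≢j = proj₂ (Apart⇒≢ (apart i≢j)) (next⇒suc i j eq)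

  x-indep : Independent t x
  x-indep i j (inj₁ next) = notNext i j next
  x-indep i j (inj₂ next) = notNext j i next

  rainbow : RainbowIndependentSet t F (suc n)
  -- There are as many sets as vertices to choose, so the index choice is the identity.
  rainbow = id , x , (λ _ _ lt → lt) , x∈F , x-inj , x-indep

theorem1p8 : (t n : ℕ) → .{{_ : NonZero t}} → 1 ≤ n → suc (2 * n) ≤ t →
    (F : Fin n → Fin n → Fin t) → (∀ i → TwoJump t n (F i)) →
    RainbowIndependentSet t F n
theorem1p8 t (suc n) _ 2n<t F jump =
  let e , t≡ = m≤n⇒∃[o]m+o≡n 2n<t in
  Rainbow.rainbow t n F jump
    (Placement.placement t (suc n) e (sym t≡) (λ i → toℕ (F i zero)) (λ i → Fin.toℕ<n (F i zero)))
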